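{- Let $p$ be an odd prime, let $1\le w<p$ be an integer and $2\le N\le p$. Let $V(w,N,p)=\#\{q_{p,w}(u) : u=0,\ldots,N-1\}$. Then $$V(w,N,p)\gg \gcd(w,p-1)\left(\frac{N}{p\log N}\right)^2,$$ with an absolute implied constant.
   Context: For an odd prime $p$ and an integer $w\ge1$, the polynomial quotient $q_{p,w}(u)$ of an integer $u\ge0$ is the unique integer with $0\le q_{p,w}(u)\le p-1$ and $q_{p,w}(u)\equiv \frac{u^w-u^{wp}}{p}\bmod p$. $A\gg B$ means $A\ge cB$ for some constant $c>0$. -}

module Defs where

open import Data.Nat using (ℕ; zero; suc; _^_; _*_)
open import Data.Nat.Properties using (_≟_)
open import Data.Integer as ℤ using (ℤ; +_; _-_)
open import Data.Integer.DivMod using (_/_; _%_)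
open import Data.List using (List; map; upTo; length; deduplicate)

-- Polynomial quotient q_{p,w}(u): the integer in [0, p-1] congruent to
-- (u^w - u^{wp}) / p modulo p.  (u^w - u^{wp} is divisible by p for p prime,
-- so the integer division is exact.)  The case p = 0 is a dummy value, never
-- used since p is prime.
q : (p w u : ℕ) → ℕ
q zero w u = 0
q (suc k) w u =
  ((+ (u ^ w) - + (u ^ (w * suc k))) / (+ suc k)) % (+ suc k)

V : (w N p : ℕ) → ℕ
V w N p = length (deduplicate _≟_ (map (q p w) (upTo N)))

{-# OPTIONS --safe #-}

-- Put d = gcd(w, p-1) and let S consist of 1 and the primes below N; then |S| ≫ N / log N by
-- Chebyshev, whose bound comes from the divisibility of ∏ l^⌊log_l N⌋ by (2n+1) C(2n,n).
-- The pair (q(u), u^w mod p) determines u^w mod p², and u^w mod p takes at most (p-1)/d values on S,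
-- so u ↦ u^w mod p² takes at most V (p-1)/d values on S.  By Cauchy–Schwarz,
-- d |S|² ≤ V (p-1) E with E the number of pairs (u, v) ∈ S² such that u^w ≡ v^w mod p².
-- For u ≠ v such a pair is determined by the root u/v of X^d - 1 mod p: since p ∤ w, two pairs
-- with the same root satisfy u v′ ≡ u′ v mod p², hence u v′ = u′ v as both sides are below p²,
-- and this forces (u, v) = (u′, v′) for primes.  So E ≤ |S| + d ≤ 2p and d |S|² ≤ 2 V p².
module Submission where

open import Defs
open import Data.Nat using (ℕ; zero; suc; z≤n; s≤s; _≤_; _<_; _≥_; _∸_; NonZero)
open import Data.List using (List; []; _∷_; _++_; length; map; filter; concatMap; upTo; replicate; deduplicate; cartesianProduct)
open import Data.List.Properties using (length-++; length-++-sucʳ; length-map; length-replicate; length-upTo; map-cong)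
open import Data.List.Membership.Propositional using (_∈_; lose)
open import Data.List.Membership.Propositional.Properties using (∈-∃++; ∈-++⁺ˡ; ∈-++⁺ʳ; ∈-++⁻; ∈-map⁺; ∈-map⁻; ∈-filter⁺; ∈-filter⁻; ∈-upTo⁺; ∈-upTo⁻; ∈-concatMap⁺; ∈-concatMap⁻; ∈-cartesianProduct⁺; ∈-cartesianProduct⁻; ∈-deduplicate⁺; ∈-deduplicate⁻)
open import Data.List.Relation.Unary.All as All using (All; []; _∷_)
import Data.List.Relation.Unary.All.Properties as All
open import Data.List.Relation.Unary.AllPairs as AllPairs using (AllPairs; []; _∷_)
import Data.List.Relation.Unary.AllPairs.Properties as AllPairs
open import Data.List.Relation.Unary.Any using (here; there; satisfied)
open import Data.List.Relation.Unary.Unique.Propositional using (Unique)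
import Data.List.Relation.Unary.Unique.Propositional.Properties as Unique
open import Data.Nat.Combinatorics using (_C_; nC1≡n; nCn≡1; nCk+nC[k+1]≡[n+1]C[k+1])
open import Data.Nat.GCD using (gcd; gcd[m,n]∣m; gcd[m,n]∣n; gcd[m,n]≢0; gcd[m,n]≤n; gcd-GCD; module Bézout)
open import Data.Nat.ListAction using (sum; product)
open import Data.Nat.Logarithm using (⌊log₂_⌋; ⌊log₂⌋-mono-≤; ⌊log₂[2^n]⌋≡n)
open import Data.Nat.Primality using (Prime; prime?; euclidsLemma; prime⇒nonZero; prime⇒nonTrivial; prime⇒irreducible; productOfPrimes≢0; ¬prime[1])
open import Data.Product using (Σ; ∃₂; _×_; _,_; proj₁; proj₂)
open import Data.Product.Properties using (≡-dec)
open import Data.Sum as Sum using (_⊎_; inj₁; inj₂; [_,_]′)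
open import Function using (_∘_; _$_)
open import Relation.Binary using (DecidableEquality; Setoid)
open import Relation.Binary.PropositionalEquality
open import Relation.Nullary using (¬_; ¬?; yes; no; contradiction)

-- Chebyshev's lower bound for the number of primes below N.

module Chebyshev where

  open import Data.Nat
  open import Data.Nat.Properties
  open import Data.Nat.Divisibility
  open import Data.Nat.DivMod using (m≡m%n+[m/n]*n; m%n<n)
  open import Data.Nat.Induction using (<-rec)
  open import Data.Nat.ListAction.Properties using (∈⇒∣product)
  open import Data.Nat.Primality.Factorisation using (factorise; PrimeFactorisation)
  open import Data.Nat.Tactic.RingSolver using (solve-∀)

  -- Absorption, by induction on `n`: Pascal's rule expands the left side and reassembles the right.
  -- It serves both Leibniz's triangle and the divisibility of `p C k` by `p`.
  [1+k]*[1+n]C[1+k] : ∀ n k → suc k * (suc n C suc k) ≡ suc n * (n C k)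
  [1+k]*[1+n]C[1+k] zero    zero    = refl
  [1+k]*[1+n]C[1+k] zero    (suc k) = *-zeroʳ k
  [1+k]*[1+n]C[1+k] (suc n) zero    = begin
    1 * (suc (suc n) C 1)       ≡⟨ *-identityˡ _ ⟩
    suc (suc n) C 1             ≡⟨ nC1≡n (suc (suc n)) ⟩
    suc (suc n)                 ≡⟨ *-identityʳ _ ⟨
    suc (suc n) * (suc n C 0)   ∎
    where open ≡-Reasoning
  [1+k]*[1+n]C[1+k] (suc n) (suc k) = begin
    suc (suc k) * (suc (suc n) C suc (suc k))
      ≡⟨ cong (suc (suc k) *_) (nCk+nC[k+1]≡[n+1]C[k+1] (suc n) (suc k)) ⟨
    suc (suc k) * (c + (suc n C suc (suc k)))
      ≡⟨ distrib (suc k) c (suc n C suc (suc k)) ⟩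
    c + (suc k * c + suc (suc k) * (suc n C suc (suc k)))
      ≡⟨ cong (c +_) (cong₂ _+_ ([1+k]*[1+n]C[1+k] n k) ([1+k]*[1+n]C[1+k] n (suc k))) ⟩
    c + (suc n * (n C k) + suc n * (n C suc k))
      ≡⟨ cong (c +_) (*-distribˡ-+ (suc n) (n C k) (n C suc k)) ⟨
    c + suc n * (n C k + n C suc k)
      ≡⟨ cong (λ x → c + suc n * x) (nCk+nC[k+1]≡[n+1]C[k+1] n k) ⟩
    suc (suc n) * c ∎
    where
    open ≡-Reasoning
    c = suc n C suc k
    distrib : ∀ k x y → suc k * (x + y) ≡ x + (k * x + suc k * y)
    distrib = solve-∀

  nCk≤[1+n]C[1+k] : ∀ n k → n C k ≤ suc n C suc k
  nCk≤[1+n]C[1+k] n k = ≤-trans (m≤m+n _ (n C suc k)) (≤-reflexive (nCk+nC[k+1]≡[n+1]C[k+1] n k))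

  nC[1+k]≤[1+n]C[1+k] : ∀ n k → n C suc k ≤ suc n C suc k
  nC[1+k]≤[1+n]C[1+k] n k = ≤-trans (m≤n+m _ (n C k)) (≤-reflexive (nCk+nC[k+1]≡[n+1]C[k+1] n k))

  nCk>0 : ∀ {n k} → k ≤ n → n C k > 0
  nCk>0 z≤n = ≤-refl
  nCk>0 {suc n} {suc k} (s≤s k≤n) = ≤-trans (nCk>0 k≤n) (nCk≤[1+n]C[1+k] n k)

  -- Pascal's rule splits C(2n+2, n+1) into two entries of row 2n+1, each at least C(2n, n).
  2^n≤2nCn : ∀ n → 2 ^ n ≤ (2 * n) C n
  2^n≤2nCn zero    = ≤-refl
  2^n≤2nCn (suc n) = begin
    2 * 2 ^ n                                         ≤⟨ *-monoʳ-≤ 2 (2^n≤2nCn n) ⟩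
    2 * c                                             ≡⟨ cong (c +_) (+-identityʳ c) ⟩
    c + c                                             ≤⟨ +-mono-≤ (c≤ n) (nCk≤[1+n]C[1+k] (2 * n) n) ⟩
    (suc (2 * n) C n) + (suc (2 * n) C suc n)         ≡⟨ nCk+nC[k+1]≡[n+1]C[k+1] (suc (2 * n)) n ⟩
    suc (suc (2 * n)) C suc n                         ≡⟨ cong (_C suc n) (*-suc 2 n) ⟨
    (2 * suc n) C suc n                               ∎
    where
    open ≤-Reasoning
    c = (2 * n) C n
    -- Pascal's rule needs a positive lower index, hence the separate case 0.
    c≤ : ∀ n → (2 * n) C n ≤ suc (2 * n) C n
    c≤ zero    = ≤-refl
    c≤ (suc n) = nC[1+k]≤[1+n]C[1+k] (2 * suc n) n

  -- The recursion 1/a + 1/c = 1/b of Leibniz's harmonic triangle, for a = n x and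
  -- c = n y, derived from Pascal's rule and two absorption identities.
  harmonic-triangle : ∀ {m n b x y z} .{{_ : NonZero m}} → x + y ≡ z → m * z ≡ n * x → m * y ≡ b →
                      b * (n * x) + b * (n * y) ≡ n * x * (n * y)
  harmonic-triangle {m} {n} {_} {x} {y} refl eq refl = *-cancelˡ-≡ _ _ m $ begin
    m * (m * y * (n * x) + m * y * (n * y))  ≡⟨ rearrange₁ m n x y ⟩
    m * y * (n * (m * (x + y)))              ≡⟨ cong (λ z → m * y * (n * z)) eq ⟩
    m * y * (n * (n * x))                    ≡⟨ rearrange₂ m n x y ⟩
    m * (n * x * (n * y))                    ∎
    where
    open ≡-Reasoning
    rearrange₁ : ∀ m n x y → m * (m * y * (n * x) + m * y * (n * y)) ≡ m * y * (n * (m * (x + y)))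
    rearrange₁ = solve-∀
    rearrange₂ : ∀ m n x y → m * y * (n * (n * x)) ≡ m * (n * x * (n * y))
    rearrange₂ = solve-∀

  -- Dividing the equation by `a * b * c` gives 1/c = 1/b - 1/a, so D/c = D/b - D/a is an integer.
  unit-fraction-∣ : ∀ {a b c D} .{{_ : NonZero a}} .{{_ : NonZero b}} →
                    b * a + b * c ≡ a * c → a ∣ D → b ∣ D → c ∣ D
  unit-fraction-∣ {a} {b} {c} {D} eq (divides x D≡xa) (divides y D≡yb) =
    ∣m+n∣m⇒∣n (subst (c ∣_) yc≡xc+D (n∣m*n y)) (n∣m*n x)
    where
    open ≡-Reasoning
    rearrange₁ : ∀ a b c y → a * b * (y * c) ≡ y * b * (a * c)
    rearrange₁ = solve-∀
    rearrange₂ : ∀ a b c D → D * (b * a + b * c) ≡ D * (b * c) + a * b * D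
    rearrange₂ = solve-∀
    rearrange₃ : ∀ a b c x D → x * a * (b * c) + a * b * D ≡ a * b * (x * c + D)
    rearrange₃ = solve-∀
    yc≡xc+D : y * c ≡ x * c + D
    yc≡xc+D = *-cancelˡ-≡ _ _ (a * b) {{m*n≢0 a b}} $ begin
      a * b * (y * c)               ≡⟨ rearrange₁ a b c y ⟩
      y * b * (a * c)               ≡⟨ cong₂ _*_ (sym D≡yb) (sym eq) ⟩
      D * (b * a + b * c)           ≡⟨ rearrange₂ a b c D ⟩
      D * (b * c) + a * b * D       ≡⟨ cong (λ z → z * (b * c) + a * b * D) D≡xa ⟩
      x * a * (b * c) + a * b * D   ≡⟨ rearrange₃ a b c x D ⟩
      a * b * (x * c + D)           ∎

  -- These products are the denominators of Leibniz's harmonic triangle. Induction on `m`: the edge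
  -- entry `suc n` is below `N`, and the reciprocal of an inner entry is a difference of two
  -- reciprocals from the preceding column.
  [1+n]*nCm∣ : ∀ {N D} → (∀ k → 1 ≤ k → k < N → k ∣ D) → ∀ m n → m ≤ n → suc n < N → suc n * (n C m) ∣ D
  [1+n]*nCm∣ {D = D} ∣D zero n _ n<N =
    subst (_∣ D) (sym (*-identityʳ (suc n))) (∣D (suc n) (s≤s z≤n) n<N)
  [1+n]*nCm∣ ∣D (suc m) (suc k) (s≤s m≤k) n<N =
    unit-fraction-∣ {{m*n≢0 (2 + k) _ {{_}} {{>-nonZero (nCk>0 (m≤n⇒m≤1+n m≤k))}}}}
                    {{m*n≢0 (suc k) _ {{_}} {{>-nonZero (nCk>0 m≤k)}}}}
      (harmonic-triangle {suc m} {2 + k} {_} {suc k C m} {suc k C suc m}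
        (nCk+nC[k+1]≡[n+1]C[k+1] (suc k) m) ([1+k]*[1+n]C[1+k] (suc k) m) ([1+k]*[1+n]C[1+k] k m))
      ([1+n]*nCm∣ ∣D m (suc k) (m≤n⇒m≤1+n m≤k) n<N)
      ([1+n]*nCm∣ ∣D m k m≤k (<-trans (n<1+n _) n<N))

  -- Prime powers and the least common multiple.

  valuation : ∀ {l} → Prime l → ∀ n → .{{NonZero n}} → ∃₂ λ a m → n ≡ l ^ a * m × ¬ l ∣ m
  valuation {l} pl = <-rec (λ n → .{{NonZero n}} → ∃₂ λ a m → n ≡ l ^ a * m × ¬ l ∣ m) step
    where
    step : ∀ n → (∀ {k} → k < n → .{{NonZero k}} → ∃₂ λ a m → k ≡ l ^ a * m × ¬ l ∣ m) →
           .{{NonZero n}} → ∃₂ λ a m → n ≡ l ^ a * m × ¬ l ∣ m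
    step n rec with l ∣? n
    ... | no  l∤n = 0 , n , sym (*-identityˡ n) , l∤n
    ... | yes l∣n@(divides _ refl) with rec (quotient-< l∣n {{prime⇒nonTrivial pl}}) {{quotient≢0 l∣n}}
    ... | a , m , k≡ , l∤m = suc a , m , trans (*-comm _ l) (trans (cong (l *_) k≡) (sym (*-assoc l (l ^ a) m))) , l∤m

  -- Induction over the prime factors of `k`. Let the tail product m contain exactly l^a, and let D
  -- = c m. Then l^(a+1) divides l m, hence D; cancelling l^a leaves l dividing c, so l m divides D.
  prime-powers-∣⇒∣ : ∀ {k D} .{{_ : NonZero k}} → (∀ {l} a → Prime l → l ^ a ∣ k → l ^ a ∣ D) → k ∣ D
  prime-powers-∣⇒∣ {k} {D} h = subst (_∣ D) (sym isFactorisation)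
      (go factors factorsPrime (λ a pl → h a pl ∘ subst (_ ∣_) (sym isFactorisation)))
    where
    open PrimeFactorisation (factorise k)
    go : ∀ ls → All Prime ls → (∀ {l} a → Prime l → l ^ a ∣ product ls → l ^ a ∣ D) → product ls ∣ D
    go []       []         h = 1∣ D
    go (l ∷ ls) (pl ∷ pls) h
      with go ls pls (λ a pl′ → h a pl′ ∘ ∣n⇒∣m*n l)
    ... | divides c D≡c*m with valuation pl (product ls) {{productOfPrimes≢0 pls}}
    ... | a , m′ , m≡ , l∤m′ = subst (l * product ls ∣_) (sym D≡c*m) (*-monoˡ-∣ (product ls) l∣c)
      where
      instance _ = prime⇒nonZero pl
      l^[1+a]∣ : l * l ^ a ∣ product ls * c
      l^[1+a]∣ = subst (l * l ^ a ∣_) (trans D≡c*m (*-comm c _))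
        (h (suc a) pl (*-monoʳ-∣ l (subst (l ^ a ∣_) (sym m≡) (m∣m*n m′))))
      l∣m′c : l ∣ m′ * c
      l∣m′c = *-cancelˡ-∣ (l ^ a) {{m^n≢0 l a}}
        (subst₂ _∣_ (*-comm l (l ^ a)) (trans (cong (_* c) m≡) (*-assoc (l ^ a) m′ c)) l^[1+a]∣)
      l∣c : l ∣ c
      l∣c with euclidsLemma m′ c pl l∣m′c
      ... | inj₁ l∣m′ = contradiction l∣m′ l∤m′
      ... | inj₂ l∣c  = l∣c

  -- Searching downwards avoids logarithms to base `l`. Starting at `e` = `N` misses nothing for `l`
  -- ≥ 2, as then l^N > N.
  max-power : (l N e : ℕ) → ℕ
  max-power l N zero    = 1
  max-power l N (suc e) with l ^ suc e <? N
  ... | yes _ = l ^ suc e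
  ... | no  _ = max-power l N e

  max-power≤ : ∀ l N e → 1 ≤ N → max-power l N e ≤ N
  max-power≤ l N zero    1≤N = 1≤N
  max-power≤ l N (suc e) 1≤N with l ^ suc e <? N
  ... | yes l^e<N = <⇒≤ l^e<N
  ... | no  _     = max-power≤ l N e 1≤N

  max-power>0 : ∀ l .{{_ : NonZero l}} N e → max-power l N e > 0
  max-power>0 l N zero    = ≤-refl
  max-power>0 l N (suc e) with l ^ suc e <? N
  ... | yes _ = m^n>0 l (suc e)
  ... | no  _ = max-power>0 l N e

  ^-monoʳ-∣ : ∀ l {a b} → a ≤ b → l ^ a ∣ l ^ b
  ^-monoʳ-∣ l {a} {b} a≤b = subst (l ^ a ∣_) (trans (sym (^-distribˡ-+-* l a (b ∸ a))) (cong (l ^_) (m+[n∸m]≡n a≤b))) (m∣m*n _)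

  ^∣max-power : ∀ l N {a} e → a ≤ e → l ^ a < N → l ^ a ∣ max-power l N e
  ^∣max-power l N zero    z≤n _    = ∣-refl
  ^∣max-power l N (suc e) a≤1+e l^a<N with l ^ suc e <? N
  ... | yes _     = ^-monoʳ-∣ l a≤1+e
  ... | no  l^e≮N = ^∣max-power l N e (≤-pred (≤∧≢⇒< a≤1+e λ { refl → l^e≮N l^a<N })) l^a<N

  n<m^n : ∀ {m} → 2 ≤ m → ∀ n → n < m ^ n
  n<m^n         2≤m zero    = ≤-refl
  n<m^n {m@(suc m-1)} 2≤m (suc n) = begin-strict
    suc n         ≤⟨ n<m^n 2≤m n ⟩
    m ^ n         <⟨ m<m*n (m ^ n) m {{m^n≢0 m n}} 2≤m ⟩
    m ^ n * m     ≡⟨ *-comm (m ^ n) m ⟩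
    m ^ suc n     ∎
    where open ≤-Reasoning

  primes : ℕ → List ℕ
  primes N = filter prime? (upTo N)

  -- This is lcm(1, ..., N - 1), written with one factor per prime so that a power of `N` bounds it
  -- at once.
  power-product : ℕ → ℕ
  power-product N = product (map (λ l → max-power l N N) (primes N))

  k∣power-product : ∀ N k → 1 ≤ k → k < N → k ∣ power-product N
  k∣power-product N k 1≤k k<N = prime-powers-∣⇒∣ h
    where
    instance _ = >-nonZero 1≤k
    h : ∀ {l} a → Prime l → l ^ a ∣ k → l ^ a ∣ power-product N
    h zero        pl _     = 1∣ _
    -- The exponent stays within the search bound, because `suc a` < `l ^ suc a` < `N`.
    h {l} (suc a) pl l^a∣k = ∣-trans (^∣max-power l N N (<⇒≤ (<-trans a<l^a l^a<N)) l^a<N)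
      (∈⇒∣product (∈-map⁺ (λ l → max-power l N N) (∈-filter⁺ prime? (∈-upTo⁺ l<N) pl)))
      where
      a<l^a : suc a < l ^ suc a
      a<l^a = n<m^n (nonTrivial⇒n>1 l {{prime⇒nonTrivial pl}}) (suc a)
      l^a<N : l ^ suc a < N
      l^a<N = ≤-<-trans (∣⇒≤ l^a∣k) k<N
      l<N : l < N
      l<N = ≤-<-trans (m≤m*n l (l ^ a) {{m^n≢0 l a {{prime⇒nonZero pl}}}}) l^a<N

  product-map-≤ : ∀ {A : Set} (f : A → ℕ) {b} → (∀ x → f x ≤ b) → ∀ xs → product (map f xs) ≤ b ^ length xs
  product-map-≤ f f≤b []       = ≤-refl
  product-map-≤ f f≤b (x ∷ xs) = *-mono-≤ (f≤b x) (product-map-≤ f f≤b xs)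

  product-map->0 : ∀ {A : Set} (f : A → ℕ) xs → (∀ {x} → x ∈ xs → f x > 0) → product (map f xs) > 0
  product-map->0 f []       f>0 = ≤-refl
  product-map->0 f (x ∷ xs) f>0 = *-mono-≤ (f>0 (here refl)) (product-map->0 f xs (f>0 ∘ there))

  power-product≤ : ∀ N → 1 ≤ N → power-product N ≤ N ^ length (primes N)
  power-product≤ N 1≤N = product-map-≤ _ (λ l → max-power≤ l N N 1≤N) (primes N)

  power-product>0 : ∀ N → power-product N > 0
  power-product>0 N = product-map->0 _ (primes N) λ l∈ →
    let _ , pl = ∈-filter⁻ prime? {xs = upTo N} l∈ in max-power>0 _ {{prime⇒nonZero pl}} N N

  n<2^[1+⌊log₂n⌋] : ∀ n → n < 2 ^ suc ⌊log₂ n ⌋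
  n<2^[1+⌊log₂n⌋] n = ≰⇒> λ 2^≤n →
    1+n≰n (subst (_≤ ⌊log₂ n ⌋) (⌊log₂[2^n]⌋≡n (suc ⌊log₂ n ⌋)) (⌊log₂⌋-mono-≤ 2^≤n))

  2^m≤2^n⇒m≤n : ∀ {m n} → 2 ^ m ≤ 2 ^ n → m ≤ n
  2^m≤2^n⇒m≤n {m} {n} le = subst₂ _≤_ (⌊log₂[2^n]⌋≡n m) (⌊log₂[2^n]⌋≡n n) (⌊log₂⌋-mono-≤ le)

  -- The chain 2^n ≤ (2n+1) C(2n, n) ≤ lcm(1, ..., N - 1) ≤ N^π ≤ 2^((L+1)π) bounds n by (L+1)π, and
  -- N ≤ 2n + 3.
  chebyshev : ∀ N → 2 ≤ N → N ≤ 4 * ⌊log₂ N ⌋ * suc (length (primes N))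
  chebyshev (suc zero) (s≤s ())
  chebyshev N@(suc (suc M)) 2≤N = begin
    2 + M                             ≡⟨ cong (2 +_) (m≡m%n+[m/n]*n M 2) ⟩
    2 + (M % 2 + n * 2)               ≤⟨ +-monoʳ-≤ 2 (+-monoˡ-≤ (n * 2) (≤-pred (m%n<n M 2))) ⟩
    -- Here and in the next line `L` ≥ 1 enters, through 3 ≤ 4L and L + 1 ≤ 2L. The summand 4L is
    -- absorbed by the `suc` on the prime count.
    3 + n * 2                         ≤⟨ +-mono-≤ 3≤4L (*-monoˡ-≤ 2 n≤) ⟩
    4 * L + suc L * π * 2             ≤⟨ +-monoʳ-≤ (4 * L) (*-monoˡ-≤ 2 (*-monoˡ-≤ π (+-monoˡ-≤ L 1≤L))) ⟩
    4 * L + (L + L) * π * 2           ≡⟨ rearrange L π ⟩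
    4 * L * suc π                     ∎
    where
    open ≤-Reasoning
    rearrange : ∀ L π → 4 * L + (L + L) * π * 2 ≡ 4 * L * (1 + π)
    rearrange = solve-∀
    -- The largest n with 2n + 1 < N.
    n = M / 2
    L = ⌊log₂ N ⌋
    π = length (primes N)
    1≤L : 1 ≤ L
    1≤L = ⌊log₂⌋-mono-≤ {2} 2≤N
    3≤4L : 3 ≤ 4 * L
    3≤4L = ≤-trans (n≤1+n 3) (*-monoʳ-≤ 4 1≤L)
    1+2n<N : suc (2 * n) < N
    1+2n<N = s≤s (s≤s (begin
      2 * n            ≡⟨ *-comm 2 n ⟩
      n * 2            ≤⟨ m≤n+m (n * 2) (M % 2) ⟩
      M % 2 + n * 2    ≡⟨ m≡m%n+[m/n]*n M 2 ⟨
      M                ∎))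
    n≤ : n ≤ suc L * π
    n≤ = 2^m≤2^n⇒m≤n (begin
      2 ^ n                        ≤⟨ 2^n≤2nCn n ⟩
      (2 * n) C n                  ≤⟨ m≤n*m _ (suc (2 * n)) ⟩
      suc (2 * n) * ((2 * n) C n)  ≤⟨ ∣⇒≤ {{>-nonZero (power-product>0 N)}}
                                        ([1+n]*nCm∣ (k∣power-product N) n (2 * n) (m≤n*m n 2) 1+2n<N) ⟩
      power-product N              ≤⟨ power-product≤ N (s≤s z≤n) ⟩
      N ^ π                        ≤⟨ ^-monoˡ-≤ π (<⇒≤ (n<2^[1+⌊log₂n⌋] N)) ⟩
      (2 ^ suc L) ^ π              ≡⟨ ^-*-assoc 2 (suc L) π ⟩
      2 ^ (suc L * π)              ∎)

-- Double counting and the Cauchy-Schwarz inequality.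

module Counting where

  open import Data.Nat
  open import Data.Nat.Properties
  open import Data.Nat.Tactic.RingSolver using (solve-∀)

  Unique-⊆⇒length≤ : ∀ {A : Set} {xs ys : List A} → Unique xs → (∀ {x} → x ∈ xs → x ∈ ys) → length xs ≤ length ys
  Unique-⊆⇒length≤ {xs = []} _ _ = z≤n
  Unique-⊆⇒length≤ {xs = x ∷ xs} (x∉xs ∷ xs!) xs⊆ys with ∈-∃++ (xs⊆ys (here refl))
  ... | as , bs , refl = begin
    suc (length xs)          ≤⟨ s≤s (Unique-⊆⇒length≤ xs! ⊆as++bs) ⟩
    suc (length (as ++ bs))  ≡⟨ length-++-sucʳ as x bs ⟨
    length (as ++ x ∷ bs)    ∎
    where
    open ≤-Reasoning
    ⊆as++bs : ∀ {z} → z ∈ xs → z ∈ as ++ bs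
    ⊆as++bs z∈xs with ∈-++⁻ as (xs⊆ys (there z∈xs))
    ... | inj₁ z∈as         = ∈-++⁺ˡ z∈as
    ... | inj₂ (here refl)  = contradiction refl (All.lookup x∉xs z∈xs)
    ... | inj₂ (there z∈bs) = ∈-++⁺ʳ as z∈bs

  Unique⇒AllPairs : ∀ {A : Set} {R : A → A → Set} {xs} → Unique xs →
                    (∀ {x y} → x ∈ xs → y ∈ xs → x ≢ y → R x y) → AllPairs R xs
  Unique⇒AllPairs []            h = []
  Unique⇒AllPairs (x∉xs ∷ xs!) h =
    All.tabulate (λ y∈xs → h (here refl) (there y∈xs) (All.lookup x∉xs y∈xs)) ∷
    Unique⇒AllPairs xs! (λ x∈ y∈ → h (there x∈) (there y∈))

  length-cartesianProduct : ∀ {A B : Set} (xs : List A) (ys : List B) → length (cartesianProduct xs ys) ≡ length xs * length ys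
  length-cartesianProduct []       ys = refl
  length-cartesianProduct (x ∷ xs) ys = trans (length-++ (map (x ,_) ys)) (cong₂ _+_ (length-map (x ,_) ys) (length-cartesianProduct xs ys))

  length-concatMap : ∀ {A B : Set} (f : A → List B) xs → length (concatMap f xs) ≡ sum (map (length ∘ f) xs)
  length-concatMap f []       = refl
  length-concatMap f (x ∷ xs) = trans (length-++ (f x)) (cong (length (f x) +_) (length-concatMap f xs))

  -- With the larger number written as the smaller plus k, the two sides differ by k²; this avoids
  -- truncated subtraction.
  2mn≤m²+n² : ∀ m n → m * n + m * n ≤ m * m + n * n
  2mn≤m²+n² m n with ≤-total m n
  ... | inj₁ m≤n = subst (λ n → m * n + m * n ≤ m * m + n * n) (m+[n∸m]≡n m≤n) (≤-trans (m≤m+n _ _) (≤-reflexive (square m (n ∸ m))))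
    where
    square : ∀ m k → m * (m + k) + m * (m + k) + k * k ≡ m * m + (m + k) * (m + k)
    square = solve-∀
  ... | inj₂ n≤m = subst (λ m → m * n + m * n ≤ m * m + n * n) (m+[n∸m]≡n n≤m) (≤-trans (m≤m+n _ _) (≤-reflexive (square n (m ∸ n))))
    where
    square : ∀ n k → (n + k) * n + (n + k) * n + k * k ≡ (n + k) * (n + k) + n * n
    square = solve-∀

  -- Cauchy-Schwarz against the constant 1. In the induction each mixed term 2 f(x) f(y) is bounded
  -- by f(x)² + f(y)².
  sum²≤length*sum-of-squares : ∀ {A : Set} (f : A → ℕ) xs →
                               sum (map f xs) * sum (map f xs) ≤ length xs * sum (map (λ x → f x * f x) xs)
  sum²≤length*sum-of-squares f []       = z≤n
  sum²≤length*sum-of-squares f (x ∷ xs) = begin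
    (c + s) * (c + s)                       ≡⟨ expand c s ⟩
    c * c + (c * s + c * s) + s * s         ≤⟨ +-mono-≤ (+-monoʳ-≤ (c * c) (cross xs)) (sum²≤length*sum-of-squares f xs) ⟩
    c * c + (l * (c * c) + t) + l * t       ≡⟨ collect l (c * c) t ⟩
    suc l * (c * c + t)                     ∎
    where
    open ≤-Reasoning
    c = f x
    s = sum (map f xs)
    t = sum (map (λ x → f x * f x) xs)
    l = length xs
    expand : ∀ c s → (c + s) * (c + s) ≡ c * c + (c * s + c * s) + s * s
    expand = solve-∀
    collect : ∀ l a t → a + (l * a + t) + l * t ≡ suc l * (a + t)
    collect = solve-∀
    cross : ∀ ys → c * sum (map f ys) + c * sum (map f ys) ≤ length ys * (c * c) + sum (map (λ x → f x * f x) ys)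
    cross []       = ≤-reflexive (cong₂ _+_ (*-zeroʳ c) (*-zeroʳ c))
    cross (y ∷ ys) = begin
      c * (f y + s′) + c * (f y + s′)                       ≡⟨ regroup₁ c (f y) s′ ⟩
      (c * f y + c * f y) + (c * s′ + c * s′)               ≤⟨ +-mono-≤ (2mn≤m²+n² c (f y)) (cross ys) ⟩
      (c * c + f y * f y) + (length ys * (c * c) + t′)      ≡⟨ regroup₂ (c * c) (f y * f y) (length ys * (c * c)) t′ ⟩
      (c * c + length ys * (c * c)) + (f y * f y + t′)      ∎
      where
      s′ = sum (map f ys)
      t′ = sum (map (λ x → f x * f x) ys)
      regroup₁ : ∀ c a b → c * (a + b) + c * (a + b) ≡ (c * a + c * a) + (c * b + c * b)
      regroup₁ = solve-∀
      regroup₂ : ∀ a b c d → (a + b) + (c + d) ≡ (a + c) + (b + d)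
      regroup₂ = solve-∀

  module Fibres {A B : Set} (_≟_ : DecidableEquality B) (key : A → B) (S : List A) (K : List B) where

    fibre : B → List A
    fibre k = filter (λ u → key u ≟ k) S

    -- Built as squares of fibres, so that its length is the sum of the squared fibre sizes. Pairs
    -- are ordered and include the diagonal.
    colliding-pairs : List (A × A)
    colliding-pairs = concatMap (λ k → cartesianProduct (fibre k) (fibre k)) K

    ∈-fibre² : ∀ {k u v} → (u , v) ∈ cartesianProduct (fibre k) (fibre k) → (u ∈ S × v ∈ S) × (key u ≡ k × key v ≡ k)
    ∈-fibre² {k} uv∈ =
      let u∈ , v∈       = ∈-cartesianProduct⁻ (fibre k) (fibre k) uv∈
          u∈S , key-u≡k = ∈-filter⁻ (λ u → key u ≟ k) {xs = S} u∈
          v∈S , key-v≡k = ∈-filter⁻ (λ u → key u ≟ k) {xs = S} v∈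
      in (u∈S , v∈S) , (key-u≡k , key-v≡k)

    ∈-colliding-pairs : ∀ {u v} → (u , v) ∈ colliding-pairs → (u ∈ S × v ∈ S) × key u ≡ key v
    ∈-colliding-pairs uv∈ =
      let _ , uv∈k = satisfied (∈-concatMap⁻ _ {xs = K} uv∈)
          uv∈S , (key-u≡k , key-v≡k) = ∈-fibre² uv∈k
      in uv∈S , trans key-u≡k (sym key-v≡k)

    colliding-pairs! : Unique S → Unique K → Unique colliding-pairs
    colliding-pairs! S! K! = Unique.concat⁺
      (All.map⁺ (All.universal (λ k → Unique.cartesianProduct⁺ (fibre! k) (fibre! k)) K))
      -- Squares over distinct keys are disjoint, since the first component has only one key.
      (AllPairs.map⁺ (AllPairs.map (λ k≢k′ {uv} (uv∈ , uv∈′) →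
        let _ , (key-u≡k  , _) = ∈-fibre² uv∈
            _ , (key-u≡k′ , _) = ∈-fibre² uv∈′
        in k≢k′ (trans (sym key-u≡k) key-u≡k′)) K!))
      where
      fibre! : ∀ k → Unique (fibre k)
      fibre! k = Unique.filter⁺ (λ u → key u ≟ k) S!

    -- The fibres over `K` cover `S`; Cauchy-Schwarz is applied to their sizes.
    length²≤ : Unique S → (∀ {u} → u ∈ S → key u ∈ K) → length S * length S ≤ length K * length colliding-pairs
    length²≤ S! key∈K = begin
      length S * length S
        ≤⟨ *-mono-≤ |S|≤ |S|≤ ⟩
      sum (map (length ∘ fibre) K) * sum (map (length ∘ fibre) K)
        ≤⟨ sum²≤length*sum-of-squares (length ∘ fibre) K ⟩
      length K * sum (map (λ k → length (fibre k) * length (fibre k)) K)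
        ≡⟨ cong (λ z → length K * sum z) (map-cong (λ k → length-cartesianProduct (fibre k) (fibre k)) K) ⟨
      length K * sum (map (λ k → length (cartesianProduct (fibre k) (fibre k))) K)
        ≡⟨ cong (length K *_) (length-concatMap _ K) ⟨
      length K * length colliding-pairs ∎
      where
      open ≤-Reasoning
      |S|≤ : length S ≤ sum (map (length ∘ fibre) K)
      |S|≤ = ≤-trans
        (Unique-⊆⇒length≤ S! λ {u} u∈S → ∈-concatMap⁺ fibre (lose (key∈K u∈S) (∈-filter⁺ (λ v → key v ≟ key u) u∈S refl)))
        (≤-reflexive (length-concatMap fibre K))

  off-diagonal : ∀ {A : Set} → DecidableEquality A → List (A × A) → List (A × A)
  off-diagonal _≟_ = filter (λ (u , v) → ¬? (u ≟ v))

  length≤diagonal+off-diagonal : ∀ {A : Set} (_≟_ : DecidableEquality A) (S : List A) {P} →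
                                 Unique P → (∀ {u v} → (u , v) ∈ P → u ∈ S) →
                                 length P ≤ length S + length (off-diagonal _≟_ P)
  length≤diagonal+off-diagonal _≟_ S {P} P! P⊆S = begin
    length P                                                       ≤⟨ Unique-⊆⇒length≤ P! split ⟩
    length (map (λ u → u , u) S ++ off-diagonal _≟_ P)             ≡⟨ length-++ (map (λ u → u , u) S) ⟩
    length (map (λ u → u , u) S) + length (off-diagonal _≟_ P)     ≡⟨ cong (_+ _) (length-map _ S) ⟩
    length S + length (off-diagonal _≟_ P)                         ∎
    where
    open ≤-Reasoning
    split : ∀ {uv} → uv ∈ P → uv ∈ map (λ u → u , u) S ++ off-diagonal _≟_ P
    split {u , v} uv∈P with u ≟ v
    ... | yes refl = ∈-++⁺ˡ (∈-map⁺ (λ u → u , u) (P⊆S uv∈P))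
    ... | no  u≢v  = ∈-++⁺ʳ _ (∈-filter⁺ (λ (u , v) → ¬? (u ≟ v)) uv∈P u≢v)

-- Congruences modulo p and p².

module Congruences where

  open import Data.Fin using (Fin; zero; suc; toℕ; fromℕ; inject₁)
  open import Data.Fin.Properties using (toℕ-fromℕ; toℕ-inject₁; toℕ<n)
  open import Data.Integer as ℤ using (ℤ; +_; 0ℤ; 1ℤ; _+_; _*_; _-_; -_; _^_)
  open import Data.Integer.DivMod using (_/_; _%_; a≡a%n+[a/n]*n; n%d<d)
  open import Data.Integer.Divisibility.Signed
  import Data.Integer.Properties as ℤ
  open import Data.Integer.Tactic.RingSolver using (solve-∀)
  import Data.Nat as ℕ
  import Data.Nat.DivMod as ℕ
  import Data.Nat.Divisibility as ℕ∣
  import Data.Nat.Properties as ℕ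
  open import Algebra.Definitions.RawSemiring ℤ.+-*-rawSemiring using () renaming (_×_ to _×ᴿ_; _^_ to _^ᴿ_)
  open import Algebra.Properties.CommutativeSemiring.Binomial ℤ.+-*-commutativeSemiring using () renaming (theorem to binomial-theorem)
  import Algebra.Properties.Monoid.Sum ℤ.+-0-monoid as Σℤ
  open import Algebra.Properties.Semiring.Binomial ℤ.+-*-semiring using (binomialTerm)

  open Chebyshev using ([1+k]*[1+n]C[1+k])

  infix 4 _≡_[mod_]

  -- A record rather than an abbreviation, so that unification can recover both sides.
  record _≡_[mod_] (x y : ℤ) (m : ℕ) : Set where
    constructor by
    field m∣x-y : + m ∣ x - y

  open _≡_[mod_]

  module _ {m : ℕ} where

    ≡⇒≡mod : ∀ {x y} → x ≡ y → x ≡ y [mod m ]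
    ≡⇒≡mod {x} refl = by (subst (+ m ∣_) (sym (ℤ.+-inverseʳ x)) (divides 0ℤ refl))

    mod-sym : ∀ {x y} → x ≡ y [mod m ] → y ≡ x [mod m ]
    mod-sym {x} {y} (by d) = by (subst (+ m ∣_) (neg-minus x y) (∣m⇒∣-m d))
      where
      neg-minus : ∀ x y → - (x - y) ≡ y - x
      neg-minus = solve-∀

    mod-trans : ∀ {x y z} → x ≡ y [mod m ] → y ≡ z [mod m ] → x ≡ z [mod m ]
    mod-trans {x} {y} {z} (by d) (by e) = by (subst (+ m ∣_) (telescope x y z) (∣m∣n⇒∣m+n d e))
      where
      telescope : ∀ x y z → (x - y) + (y - z) ≡ x - z
      telescope = solve-∀

    +-cong-mod : ∀ {x y u v} → x ≡ y [mod m ] → u ≡ v [mod m ] → x + u ≡ y + v [mod m ]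
    +-cong-mod {x} {y} {u} {v} (by d) (by e) = by (subst (+ m ∣_) (rearrange x y u v) (∣m∣n⇒∣m+n d e))
      where
      rearrange : ∀ x y u v → (x - y) + (u - v) ≡ (x + u) - (y + v)
      rearrange = solve-∀

    *-cong-mod : ∀ {x y u v} → x ≡ y [mod m ] → u ≡ v [mod m ] → x * u ≡ y * v [mod m ]
    *-cong-mod {x} {y} {u} {v} (by d) (by e) =
      by (subst (+ m ∣_) (rearrange x y u v) (∣m∣n⇒∣m+n (∣m⇒∣m*n u d) (∣n⇒∣m*n y e)))
      where
      rearrange : ∀ x y u v → (x - y) * u + y * (u - v) ≡ x * u - y * v
      rearrange = solve-∀

    +-congˡ-mod : ∀ x {u v} → u ≡ v [mod m ] → x + u ≡ x + v [mod m ]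
    +-congˡ-mod x = +-cong-mod {x} (≡⇒≡mod refl)

    *-congˡ-mod : ∀ x {u v} → u ≡ v [mod m ] → x * u ≡ x * v [mod m ]
    *-congˡ-mod x = *-cong-mod {x} (≡⇒≡mod refl)

    ^-cong-mod : ∀ {x y} n → x ≡ y [mod m ] → x ^ n ≡ y ^ n [mod m ]
    ^-cong-mod zero    _   = ≡⇒≡mod refl
    ^-cong-mod (suc n) x≡y = *-cong-mod x≡y (^-cong-mod n x≡y)

    mod-setoid : Setoid _ _
    mod-setoid = record
      { _≈_ = _≡_[mod m ]
      ; isEquivalence = record { refl = ≡⇒≡mod refl ; sym = mod-sym ; trans = mod-trans }
      }

    ∣⇒≡0mod : ∀ {x} → + m ∣ x → x ≡ 0ℤ [mod m ]
    ∣⇒≡0mod {x} d = by (subst (+ m ∣_) (sym (ℤ.+-identityʳ x)) d)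

    ≡0mod⇒∣ : ∀ {x} → x ≡ 0ℤ [mod m ] → + m ∣ x
    ≡0mod⇒∣ {x} (by d) = subst (+ m ∣_) (ℤ.+-identityʳ x) d

    ^≡1mod : ∀ {x} n k → x ^ n ≡ 1ℤ [mod m ] → x ^ (n ℕ.* k) ≡ 1ℤ [mod m ]
    ^≡1mod {x} n k x^n≡1 = mod-trans (≡⇒≡mod (sym (ℤ.^-*-assoc x n k)))
      (mod-trans (^-cong-mod k x^n≡1) (≡⇒≡mod (ℤ.^-zeroˡ k)))

    -- Bézout without subtraction: x^g = x^g x^(tb) = x^(sa) = 1.
    from-bézout : ∀ {x a b g} s t → x ^ a ≡ 1ℤ [mod m ] → x ^ b ≡ 1ℤ [mod m ] →
                  g ℕ.+ t ℕ.* b ≡ s ℕ.* a → x ^ g ≡ 1ℤ [mod m ]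
    from-bézout {x} {a} {b} {g} s t x^a≡1 x^b≡1 eq = begin
      x ^ g                        ≡⟨ ℤ.*-identityʳ _ ⟨
      x ^ g * 1ℤ                   ≈⟨ *-congˡ-mod (x ^ g) (^≡1mod b t x^b≡1) ⟨
      x ^ g * x ^ (b ℕ.* t)        ≡⟨ cong (λ n → x ^ g * x ^ n) (ℕ.*-comm b t) ⟩
      x ^ g * x ^ (t ℕ.* b)        ≡⟨ ℤ.^-distribˡ-+-* x g (t ℕ.* b) ⟨
      x ^ (g ℕ.+ t ℕ.* b)          ≡⟨ cong (x ^_) (trans eq (ℕ.*-comm s a)) ⟩
      x ^ (a ℕ.* s)                ≈⟨ ^≡1mod a s x^a≡1 ⟩
      1ℤ                           ∎
      where open import Relation.Binary.Reasoning.Setoid mod-setoid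

    ^-gcd≡1mod : ∀ {x} a b → x ^ a ≡ 1ℤ [mod m ] → x ^ b ≡ 1ℤ [mod m ] → x ^ gcd a b ≡ 1ℤ [mod m ]
    ^-gcd≡1mod a b x^a≡1 x^b≡1 with Bézout.identity (gcd-GCD a b)
    ... | Bézout.+- s t eq = from-bézout {a = a} {b} s t x^a≡1 x^b≡1 eq
    ... | Bézout.-+ s t eq = from-bézout {a = b} {a} t s x^b≡1 x^a≡1 eq

  ∣-*-prime : ∀ {p} → Prime p → ∀ x y → + p ∣ x * y → + p ∣ x ⊎ + p ∣ y
  ∣-*-prime pp x y d = Sum.map ∣ᵤ⇒∣ ∣ᵤ⇒∣
    (euclidsLemma ℤ.∣ x ∣ ℤ.∣ y ∣ pp (subst (_ ℕ∣.∣_) (ℤ.abs-* x y) (∣⇒∣ᵤ d)))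

  ∤1-prime : ∀ {p} → Prime p → ¬ + p ∣ 1ℤ
  ∤1-prime pp p∣1 = contradiction (∣⇒∣ᵤ p∣1) (ℕ∣.>⇒∤ (ℕ.nonTrivial⇒n>1 _ {{prime⇒nonTrivial pp}}))

  ∤-^-prime : ∀ {p} → Prime p → ∀ x n → ¬ + p ∣ x → ¬ + p ∣ x ^ n
  ∤-^-prime pp x zero    p∤x p∣1 = ∤1-prime pp p∣1
  ∤-^-prime pp x (suc n) p∤x p∣x^n with ∣-*-prime pp x (x ^ n) p∣x^n
  ... | inj₁ p∣x  = p∤x p∣x
  ... | inj₂ p∣x′ = ∤-^-prime pp x n p∤x p∣x′

  ∤⇒∣-*-prime : ∀ {p} → Prime p → ∀ x y → ¬ + p ∣ x → + p ∣ x * y → + p ∣ y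
  ∤⇒∣-*-prime pp x y p∤x p∣xy = Sum.fromInj₂ (λ p∣x → contradiction p∣x p∤x) (∣-*-prime pp x y p∣xy)

  *-cancelˡ-mod : ∀ {p} → Prime p → ∀ x {y z} → ¬ + p ∣ x → x * y ≡ x * z [mod p ] → y ≡ z [mod p ]
  *-cancelˡ-mod {p} pp x {y} {z} p∤x (by d) =
    by (∤⇒∣-*-prime pp x (y - z) p∤x (subst (+ p ∣_) (factor x y z) d))
    where
    factor : ∀ x y z → x * y - x * z ≡ x * (y - z)
    factor = solve-∀

  -- Fermat's little theorem

  -- By absorption `p` divides k C(p, k), and it cannot divide k as 0 < k < p.
  p∣pCk : ∀ {p} → Prime p → ∀ {k} → 0 ℕ.< k → k ℕ.< p → p ℕ∣.∣ p C k
  p∣pCk {suc p-1} pp {suc k} _ k<p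
    with euclidsLemma (suc k) (suc p-1 C suc k) pp
           (subst (suc p-1 ℕ∣.∣_) (sym ([1+k]*[1+n]C[1+k] p-1 k)) (ℕ∣.m∣m*n (p-1 C k)))
  ... | inj₁ p∣k = contradiction p∣k (ℕ∣.>⇒∤ k<p)
  ... | inj₂ p∣C = p∣C

  ×≡* : ∀ n x → n ×ᴿ x ≡ + n * x
  ×≡* zero    x = refl
  ×≡* (suc n) x = trans (cong (λ z → x + z) (×≡* n x)) (sym (ℤ.suc-* (+ n) x))

  ^≡^ : ∀ x n → x ^ᴿ n ≡ x ^ n
  ^≡^ x zero    = refl
  ^≡^ x (suc n) = cong (x *_) (^≡^ x n)

  ∣-sum : ∀ {m n} (t : Fin n → ℤ) → (∀ i → m ∣ t i) → m ∣ Σℤ.sum t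
  ∣-sum {n = zero}  t h = divides 0ℤ refl
  ∣-sum {n = suc n} t h = ∣m∣n⇒∣m+n (h zero) (∣-sum (t ∘ suc) (h ∘ suc))

  -- All but the two outer terms of the binomial expansion are divisible by `p`. This is the
  -- inductive step for Fermat.
  freshman's-dream : ∀ {p} → Prime p → ∀ x → (x + 1ℤ) ^ p ≡ x ^ p + 1ℤ [mod p ]
  freshman's-dream {p@(suc p-1)} pp x = begin
    (x + 1ℤ) ^ p                                ≡⟨ ^≡^ (x + 1ℤ) p ⟨
    (x + 1ℤ) ^ᴿ p                               ≡⟨ binomial-theorem p x 1ℤ ⟩
    Σℤ.sum t                                    ≡⟨⟩
    t zero + Σℤ.sum (t ∘ suc)                   ≡⟨ cong (λ z → t zero + z) (Σℤ.sum-init-last (t ∘ suc)) ⟩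
    t zero + (Σℤ.sum mid + t (fromℕ p))         ≈⟨ +-cong-mod {m = p} (≡⇒≡mod t-first)
                                                     (+-cong-mod (∣⇒≡0mod (∣-sum mid p∣mid)) (≡⇒≡mod t-last)) ⟩
    1ℤ + (0ℤ + x ^ p)                           ≡⟨ cong (λ z → 1ℤ + z) (ℤ.+-identityˡ (x ^ p)) ⟩
    1ℤ + x ^ p                                  ≡⟨ ℤ.+-comm 1ℤ (x ^ p) ⟩
    x ^ p + 1ℤ                                  ∎
    where
    open import Relation.Binary.Reasoning.Setoid (mod-setoid {p})
    t : Fin (suc p) → ℤ
    t = binomialTerm x 1ℤ p
    mid : Fin p-1 → ℤ
    mid i = t (suc (inject₁ i))
    1^ : ∀ n → 1ℤ ^ᴿ n ≡ 1ℤ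
    1^ n = trans (^≡^ 1ℤ n) (ℤ.^-zeroˡ n)
    -- The term of index k carries x^k, so the first term is 1 and the last is x^p.
    t-first : t zero ≡ 1ℤ
    t-first = trans (ℤ.+-identityʳ _) (trans (ℤ.*-identityˡ _) (1^ p))
    t-last : t (fromℕ p) ≡ x ^ p
    t-last rewrite toℕ-fromℕ p-1 | nCn≡1 p | ℕ.n∸n≡0 p-1 =
      trans (ℤ.+-identityʳ _) (trans (ℤ.*-identityʳ _) (^≡^ x p))
    p∣mid : ∀ i → + p ∣ mid i
    p∣mid i rewrite toℕ-inject₁ i =
      subst (+ p ∣_) (sym (×≡* (p C suc (toℕ i)) _))
        (∣m⇒∣m*n _ (∣ᵤ⇒∣ {+ p} {+ (p C suc (toℕ i))} (p∣pCk pp (s≤s z≤n) (s≤s (toℕ<n i)))))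

  fermat : ∀ {p} → Prime p → ∀ a → (+ a) ^ p ≡ + a [mod p ]
  fermat {suc p-1} pp zero    = ≡⇒≡mod refl
  fermat {p}       pp (suc a) = begin
    (+ suc a) ^ p      ≡⟨ cong (_^ p) (ℤ.+-comm 1ℤ (+ a)) ⟩
    (+ a + 1ℤ) ^ p     ≈⟨ freshman's-dream pp (+ a) ⟩
    (+ a) ^ p + 1ℤ     ≈⟨ +-cong-mod (fermat pp a) (≡⇒≡mod refl) ⟩
    + a + 1ℤ           ≡⟨ ℤ.+-comm 1ℤ (+ a) ⟨
    + suc a            ∎
    where open import Relation.Binary.Reasoning.Setoid (mod-setoid {p})

  fermat′ : ∀ {p} → Prime p → ∀ a → ¬ + p ∣ + a → (+ a) ^ (p ℕ.∸ 1) ≡ 1ℤ [mod p ]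
  fermat′ {suc p-1} pp a p∤a = *-cancelˡ-mod pp (+ a) p∤a
    (mod-trans (fermat pp a) (≡⇒≡mod (sym (ℤ.*-identityʳ (+ a)))))

  -- Lagrange's theorem

  -- A list cs of coefficients stands for the monic polynomial
  -- cs₀ + cs₁ x + … + x ^ length cs.
  eval : List ℤ → ℤ → ℤ
  eval []       x = 1ℤ
  eval (c ∷ cs) x = c + x * eval cs x

  -- Synthetic division of c ∷ cs by x - a.
  quotient-by : ℤ → ℤ → List ℤ → List ℤ
  quotient-by a c []        = []
  quotient-by a c (c′ ∷ cs) = eval (c′ ∷ cs) a ∷ quotient-by a c′ cs

  length-quotient-by : ∀ a c cs → length (quotient-by a c cs) ≡ length cs
  length-quotient-by a c []        = refl
  length-quotient-by a c (c′ ∷ cs) = cong suc (length-quotient-by a c′ cs)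

  -- Factor theorem with remainder. Writing P = c + X P₁, one has P(x) - P(a) = (x - a) P₁(a) + x
  -- (P₁(x) - P₁(a)), and induction applies to P₁.
  eval-quotient-by : ∀ a c cs x → eval (c ∷ cs) x - eval (c ∷ cs) a ≡ (x - a) * eval (quotient-by a c cs) x
  eval-quotient-by a c []        x = linear a c x
    where
    linear : ∀ a c x → (c + x * 1ℤ) - (c + a * 1ℤ) ≡ (x - a) * 1ℤ
    linear = solve-∀
  eval-quotient-by a c (c′ ∷ cs) x = begin
    (c + x * P x) - (c + a * P a)          ≡⟨ split a c x (P x) (P a) ⟩
    (x - a) * P a + x * (P x - P a)        ≡⟨ cong (λ z → (x - a) * P a + x * z) (eval-quotient-by a c′ cs x) ⟩
    (x - a) * P a + x * ((x - a) * Q)      ≡⟨ collect a x (P a) Q ⟩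
    (x - a) * (P a + x * Q)                ∎
    where
    open ≡-Reasoning
    P = eval (c′ ∷ cs)
    Q = eval (quotient-by a c′ cs) x
    split : ∀ a c x Px Pa → (c + x * Px) - (c + a * Pa) ≡ (x - a) * Pa + x * (Px - Pa)
    split = solve-∀
    collect : ∀ a x Pa Q → (x - a) * Pa + x * ((x - a) * Q) ≡ (x - a) * (Pa + x * Q)
    collect = solve-∀

  -- Splitting off a root `a` leaves a monic quotient; any other root r is a root of it, since `p`
  -- is prime and does not divide r - a. The induction ends at the constant 1, which has no root.
  lagrange : ∀ {p} → Prime p → ∀ cs {rs} → AllPairs (λ r s → ¬ r ≡ s [mod p ]) rs →
             All (λ r → eval cs r ≡ 0ℤ [mod p ]) rs → length rs ℕ.≤ length cs
  lagrange pp cs       []        []              = z≤n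
  lagrange pp []       (_ ∷ _)   (1≡0 ∷ _)       = contradiction (≡0mod⇒∣ 1≡0) (∤1-prime pp)
  lagrange {p} pp (c ∷ cs) {a ∷ rs} (a≢ ∷ rs≢) (Pa≡0 ∷ Prs≡0) =
    s≤s (subst (length rs ℕ.≤_) (length-quotient-by a c cs)
      (lagrange pp (quotient-by a c cs) rs≢ (All.zipWith root (a≢ , Prs≡0))))
    where
    root : ∀ {r} → (¬ a ≡ r [mod p ]) × eval (c ∷ cs) r ≡ 0ℤ [mod p ] → eval (quotient-by a c cs) r ≡ 0ℤ [mod p ]
    root {r} (a≢r , Pr≡0) = ∣⇒≡0mod (∤⇒∣-*-prime pp (r - a) _ (λ p∣r-a → a≢r (mod-sym (by p∣r-a)))
      (subst (+ p ∣_) (eval-quotient-by a c cs r) (m∣x-y (mod-trans Pr≡0 (mod-sym Pa≡0)))))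

  roots-of-unity-≤ : ∀ {p} → Prime p → ∀ n .{{_ : ℕ.NonZero n}} {rs} → AllPairs (λ r s → ¬ r ≡ s [mod p ]) rs →
                     All (λ r → r ^ n ≡ 1ℤ [mod p ]) rs → length rs ℕ.≤ n
  roots-of-unity-≤ {p} pp (suc n) {rs} rs≢ rs^n≡1 =
    -- The coefficient list stands for X^(n+1) - 1, the leading 1 being implicit.
    subst (λ k → length rs ℕ.≤ suc k) (length-replicate n) (lagrange pp (- 1ℤ ∷ replicate n 0ℤ) rs≢ (All.map (λ {r} → root {r}) rs^n≡1))
    where
    eval-replicate : ∀ n x → eval (replicate n 0ℤ) x ≡ x ^ n
    eval-replicate zero    x = refl
    eval-replicate (suc n) x = trans (ℤ.+-identityˡ _) (cong (x *_) (eval-replicate n x))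
    root : ∀ {r} → r ^ suc n ≡ 1ℤ [mod p ] → eval (- 1ℤ ∷ replicate n 0ℤ) r ≡ 0ℤ [mod p ]
    root {r} r^n≡1 rewrite eval-replicate n r = +-congˡ-mod (- 1ℤ) r^n≡1

  -- Lifting congruences from p to p²

  -- The cofactor x^(n-1) + x^(n-2) y + ... + y^(n-1) of x - y in x^n - y^n.
  geometric : ℕ → ℤ → ℤ → ℤ
  geometric zero    x y = 0ℤ
  geometric (suc n) x y = x ^ n + y * geometric n x y

  ^-minus-^ : ∀ n x y → x ^ n - y ^ n ≡ (x - y) * geometric n x y
  ^-minus-^ zero    x y = sym (ℤ.*-zeroʳ (x - y))
  ^-minus-^ (suc n) x y = begin
    x * x ^ n - y * y ^ n                             ≡⟨ split x y (x ^ n) (y ^ n) ⟩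
    (x - y) * x ^ n + y * (x ^ n - y ^ n)             ≡⟨ cong (λ z → (x - y) * x ^ n + y * z) (^-minus-^ n x y) ⟩
    (x - y) * x ^ n + y * ((x - y) * geometric n x y) ≡⟨ collect x y (x ^ n) (geometric n x y) ⟩
    (x - y) * (x ^ n + y * geometric n x y)           ∎
    where
    open ≡-Reasoning
    split : ∀ x y a b → x * a - y * b ≡ (x - y) * a + y * (a - b)
    split = solve-∀
    collect : ∀ x y a g → (x - y) * a + y * ((x - y) * g) ≡ (x - y) * (a + y * g)
    collect = solve-∀

  -- For x ≡ y each of the n terms is x^(n-1). At n = 0 the truncated exponent is harmless, as the
  -- factor n vanishes.
  geometric≡ : ∀ {m x y} n → x ≡ y [mod m ] → geometric n x y ≡ + n * x ^ (n ℕ.∸ 1) [mod m ]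
  geometric≡ zero _ = ≡⇒≡mod refl
  geometric≡ {m} {x} {y} (suc zero) _ = ≡⇒≡mod (cong (λ z → 1ℤ + z) (ℤ.*-zeroʳ y))
  geometric≡ {m} {x} {y} (suc (suc n)) x≡y = begin
    x ^ suc n + y * geometric (suc n) x y        ≈⟨ +-congˡ-mod (x ^ suc n) (*-cong-mod (mod-sym x≡y) (geometric≡ (suc n) x≡y)) ⟩
    x ^ suc n + x * (+ suc n * x ^ n)            ≡⟨ collect x (+ suc n) (x ^ n) ⟩
    (1ℤ + + suc n) * x ^ suc n                   ∎
    where
    open import Relation.Binary.Reasoning.Setoid (mod-setoid {m})
    collect : ∀ x c a → x * a + x * (c * a) ≡ (1ℤ + c) * (x * a)
    collect = solve-∀

  -- In x^p - y^p = (x - y) G both factors are divisible by `p`, because G ≡ p x^(p-1).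
  ^p-lift : ∀ {p x y} → x ≡ y [mod p ] → x ^ p ≡ y ^ p [mod p ℕ.* p ]
  ^p-lift {p} {x} {y} x≡y = by (subst₂ _∣_ (sym (ℤ.pos-* p p)) (sym (^-minus-^ p x y))
    (∣-trans (*-monoʳ-∣ (+ p) p∣G) (*-monoˡ-∣ (geometric p x y) (m∣x-y x≡y))))
    where
    p∣G : + p ∣ geometric p x y
    p∣G = ≡0mod⇒∣ (mod-trans (geometric≡ p x≡y) (∣⇒≡0mod (∣m⇒∣m*n _ ∣-refl)))

  -- Here G ≡ n x^(n-1) is prime to `p`. With x - y = t p, the divisibility of p G t by p² forces
  -- `p` to divide t.
  ^-unlift : ∀ {p} → Prime p → ∀ {n x y} → ¬ + p ∣ + n → ¬ + p ∣ x → x ≡ y [mod p ] →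
             x ^ n ≡ y ^ n [mod p ℕ.* p ] → x ≡ y [mod p ℕ.* p ]
  ^-unlift {p} pp {n} {x} {y} p∤n p∤x x≡y@(by (divides t x-y≡tp)) (by d) =
    by (subst₂ _∣_ (sym (ℤ.pos-* p p)) (sym x-y≡tp) (*-monoˡ-∣ (+ p) p∣t))
    where
    instance _ = prime⇒nonZero pp
    G = geometric n x y
    p∤G : ¬ + p ∣ G
    p∤G p∣G = ∤-^-prime pp x (n ℕ.∸ 1) p∤x
      (∤⇒∣-*-prime pp (+ n) _ p∤n (≡0mod⇒∣ (mod-trans (mod-sym (geometric≡ n x≡y)) (∣⇒≡0mod p∣G))))
    xⁿ-yⁿ≡ : x ^ n - y ^ n ≡ + p * (G * t)
    xⁿ-yⁿ≡ = trans (^-minus-^ n x y) (trans (cong (_* G) x-y≡tp) (rearrange t (+ p) G))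
      where
      rearrange : ∀ t p G → t * p * G ≡ p * (G * t)
      rearrange = solve-∀
    p∣t : + p ∣ t
    p∣t = ∤⇒∣-*-prime pp G t p∤G (*-cancelˡ-∣ (+ p) (subst₂ _∣_ (ℤ.pos-* p p) xⁿ-yⁿ≡ d))

  pos-^ : ∀ u n → + (u ℕ.^ n) ≡ (+ u) ^ n
  pos-^ u zero    = refl
  pos-^ u (suc n) = trans (ℤ.pos-* u (u ℕ.^ n)) (cong (+ u *_) (pos-^ u n))

  ^-distribʳ-* : ∀ n x y → (x * y) ^ n ≡ x ^ n * y ^ n
  ^-distribʳ-* zero    x y = refl
  ^-distribʳ-* (suc n) x y = trans (cong (x * y *_) (^-distribʳ-* n x y)) (interchange x y (x ^ n) (y ^ n))
    where
    interchange : ∀ x y a b → x * y * (a * b) ≡ x * a * (y * b)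
    interchange = solve-∀

  %-≡mod : ∀ a m .{{_ : NonZero m}} → + a ≡ + (a ℕ.% m) [mod m ]
  %-≡mod a m = by (divides (+ (a ℕ./ m)) (begin
    + a - + (a ℕ.% m)                                         ≡⟨ cong (λ z → + z - + (a ℕ.% m)) (ℕ.m≡m%n+[m/n]*n a m) ⟩
    + (a ℕ.% m ℕ.+ a ℕ./ m ℕ.* m) - + (a ℕ.% m)               ≡⟨ cong (_- + (a ℕ.% m)) (trans (ℤ.pos-+ (a ℕ.% m) _) (cong (λ z → + (a ℕ.% m) + z) (ℤ.pos-* (a ℕ./ m) m))) ⟩
    + (a ℕ.% m) + + (a ℕ./ m) * + m - + (a ℕ.% m)             ≡⟨ cancel (+ (a ℕ.% m)) (+ (a ℕ./ m) * + m) ⟩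
    + (a ℕ./ m) * + m                                         ∎))
    where
    open ≡-Reasoning
    cancel : ∀ x y → x + y - x ≡ y
    cancel = solve-∀

  %≡%⇒≡mod : ∀ {a b} m .{{_ : NonZero m}} → a ℕ.% m ≡ b ℕ.% m → + a ≡ + b [mod m ]
  %≡%⇒≡mod {a} {b} m eq = mod-trans (%-≡mod a m) (mod-trans (≡⇒≡mod (cong +_ eq)) (mod-sym (%-≡mod b m)))

  ≡mod⇒≡ : ∀ {a b m} → a < m → b < m → + a ≡ + b [mod m ] → a ≡ b
  ≡mod⇒≡ {a} {b} {m} a<m b<m a≡b =
    [ (λ a≤b → sym (lemma b<m a≤b (m∣x-y (mod-sym a≡b)))) , (λ b≤a → lemma a<m b≤a (m∣x-y a≡b)) ]′ (ℕ.≤-total a b)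
    where
    lemma : ∀ {a b} → a < m → b ≤ a → + m ∣ + a - + b → a ≡ b
    lemma {a} {b} a<m b≤a d with a ∸ b in eq | subst (m ℕ∣.∣_) (cong ℤ.∣_∣ (trans (ℤ.m-n≡m⊖n a b) (ℤ.⊖-≥ b≤a))) (∣⇒∣ᵤ d)
    ... | zero  | _ = ℕ.≤-antisym (ℕ.m∸n≡0⇒m≤n eq) b≤a
    ... | suc k | m∣ = contradiction m∣ (ℕ∣.>⇒∤ (ℕ.≤-<-trans (ℕ.≤-trans (ℕ.≤-reflexive (sym eq)) (ℕ.m∸n≤m a b)) a<m))

  pos-∤ : ∀ {m n} .{{_ : NonZero n}} → n < m → ¬ + m ∣ + n
  pos-∤ n<m m∣n = ℕ∣.>⇒∤ n<m (∣⇒∣ᵤ m∣n)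

  -- Polynomial quotients

  -- The division is exact: X = Q p, and Q = r + T p gives X = r p + T p².
  [x/p]%p : ∀ k X → let p = suc k in + p ∣ X → X ≡ + ((X / + p) % + p) * + p [mod p ℕ.* p ]
  [x/p]%p k X p∣X = by (divides T (begin
    X - + r * + p                       ≡⟨ cong (λ z → z - + r * + p) (trans X≡Qp (cong (_* + p) (a≡a%n+[a/n]*n Q (+ p)))) ⟩
    (+ r + T * + p) * + p - + r * + p   ≡⟨ cancel (+ r) T (+ p) ⟩
    T * (+ p * + p)                     ≡⟨ cong (T *_) (ℤ.pos-* p p) ⟨
    T * + (p ℕ.* p)                     ∎))
    where
    open ≡-Reasoning
    p = suc k
    Q = X / + p
    r = Q % + p
    T = Q / + p
    cancel : ∀ r T p → (r + T * p) * p - r * p ≡ T * (p * p)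
    cancel = solve-∀
    X%p≡0 : X % + p ≡ 0
    X%p≡0 with X % + p | n%d<d X (+ p) | ∣m+n∣n⇒∣m {+ p} {+ (X % + p)} (subst (+ p ∣_) (a≡a%n+[a/n]*n X (+ p)) p∣X) (∣n⇒∣m*n Q ∣-refl)
    ... | zero  | _   | _   = refl
    ... | suc s | s<p | p∣s = contradiction p∣s (pos-∤ s<p)
    X≡Qp : X ≡ Q * + p
    X≡Qp = trans (a≡a%n+[a/n]*n X (+ p)) (trans (cong (λ z → + z + Q * + p) X%p≡0) (ℤ.+-identityˡ _))

  -- Fermat's theorem for u^w makes the numerator in `q` divisible by `p`, so `[x/p]%p` applies.
  q-spec : ∀ {p} → Prime p → ∀ w u → (+ u) ^ w - ((+ u) ^ w) ^ p ≡ + q p w u * + p [mod p ℕ.* p ]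
  q-spec {p@(suc k)} pp w u = mod-trans (≡⇒≡mod (sym X≡)) ([x/p]%p k X (m∣x-y X≡0))
    where
    X = + (u ℕ.^ w) - + (u ℕ.^ (w ℕ.* p))
    X≡ : X ≡ (+ u) ^ w - ((+ u) ^ w) ^ p
    X≡ = cong₂ _-_ (pos-^ u w) (trans (pos-^ u (w ℕ.* p)) (sym (ℤ.^-*-assoc (+ u) w p)))
    X≡0 : + (u ℕ.^ w) ≡ + (u ℕ.^ (w ℕ.* p)) [mod p ]
    X≡0 = mod-sym (mod-trans (≡⇒≡mod (trans (cong +_ (sym (ℕ.^-*-assoc u w p))) (pos-^ (u ℕ.^ w) p))) (fermat pp (u ℕ.^ w)))

  -- x = (x - x ^ p) + x ^ p, where x ^ p mod p² depends only on x mod p.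
  q-lift : ∀ {p} → Prime p → ∀ w u v → q p w u ≡ q p w v → (+ u) ^ w ≡ (+ v) ^ w [mod p ] →
           (+ u) ^ w ≡ (+ v) ^ w [mod p ℕ.* p ]
  q-lift {p} pp w u v q≡ x≡y = begin
    x                       ≡⟨ split x (x ^ p) ⟩
    (x - x ^ p) + x ^ p     ≈⟨ +-cong-mod (q-spec pp w u) (^p-lift x≡y) ⟩
    + q p w u * + p + y ^ p ≡⟨ cong (λ z → + z * + p + y ^ p) q≡ ⟩
    + q p w v * + p + y ^ p ≈⟨ +-cong-mod (q-spec pp w v) (≡⇒≡mod refl) ⟨
    (y - y ^ p) + y ^ p     ≡⟨ split y (y ^ p) ⟨
    y                       ∎
    where
    open import Relation.Binary.Reasoning.Setoid (mod-setoid {p ℕ.* p})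
    x = (+ u) ^ w
    y = (+ v) ^ w
    split : ∀ a b → a ≡ (a - b) + b
    split = solve-∀

-- Collisions of w-th powers of 1 and the primes below N.

module ValueSet where

  open import Data.Integer using (ℤ; +_; 1ℤ; _*_; _^_)
  open import Data.Integer.Divisibility.Signed using (_∣_)
  import Data.Integer.Properties as ℤ
  open import Data.Integer.Tactic.RingSolver using (solve-∀)
  open import Data.List.Relation.Unary.Unique.DecPropositional.Properties using (deduplicate-!)
  import Data.Nat as ℕ
  import Data.Nat.DivMod as ℕ
  import Data.Nat.Divisibility as ℕ∣
  import Data.Nat.Properties as ℕ
  open import Data.Nat.Tactic.RingSolver using () renaming (solve-∀ to ℕ-solve-∀)

  open Chebyshev using (primes; chebyshev)
  open Counting
  open Congruences

  OneOrPrime : ℕ → Set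
  OneOrPrime n = n ≡ 1 ⊎ Prime n

  prime∣⇒≡ : ∀ {a b} → Prime a → OneOrPrime b → a ℕ∣.∣ b → a ≡ b
  prime∣⇒≡ pa (inj₁ refl) a∣1 = contradiction (subst Prime (ℕ∣.∣1⇒≡1 a∣1) pa) ¬prime[1]
  prime∣⇒≡ pa (inj₂ pb)   a∣b with prime⇒irreducible pb a∣b
  ... | inj₁ refl = contradiction pa ¬prime[1]
  ... | inj₂ a≡b  = a≡b

  OneOrPrime⇒NonZero : ∀ {a} → OneOrPrime a → NonZero a
  OneOrPrime⇒NonZero (inj₁ refl) = _
  OneOrPrime⇒NonZero (inj₂ pa)   = prime⇒nonZero pa

  -- Uniqueness of lowest terms: distinct members of {1} ∪ primes are coprime. The condition `a ≢ b`
  -- excludes the ratio 1, shared by all diagonal pairs.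
  ratio-injective : ∀ {a b c d} → OneOrPrime a → OneOrPrime b → OneOrPrime c → OneOrPrime d →
                    a ≢ b → a ℕ.* d ≡ c ℕ.* b → a ≡ c × b ≡ d
  ratio-injective {a} {b} {c} {d} (inj₂ pa) hb hc hd a≢b eq with euclidsLemma c b pa (subst (a ℕ∣.∣_) eq (ℕ∣.m∣m*n d))
  ... | inj₂ a∣b = contradiction (prime∣⇒≡ pa hb a∣b) a≢b
  ... | inj₁ a∣c with prime∣⇒≡ pa hc a∣c
  ... | refl = refl , sym (ℕ.*-cancelˡ-≡ d b a {{prime⇒nonZero pa}} eq)
  ratio-injective (inj₁ refl) (inj₁ refl) _ _ a≢b _ = contradiction refl a≢b
  ratio-injective {b = b} {c} {d} (inj₁ refl) (inj₂ pb) hc hd a≢b eq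
    with prime∣⇒≡ pb hd (subst (b ℕ∣.∣_) (sym (trans (sym (ℕ.*-identityˡ d)) eq)) (ℕ∣.n∣m*n c))
  ... | refl = ℕ.*-cancelʳ-≡ 1 c b {{prime⇒nonZero pb}} eq , refl

  module Count {p w N : ℕ} (pp : Prime p) (1≤w : 1 ≤ w) (w≤p-1 : w ≤ p ∸ 1) (2≤N : 2 ≤ N) (N≤p : N ≤ p) where

    instance
      p≢0 : NonZero p
      p≢0 = prime⇒nonZero pp
      w≢0 : NonZero w
      w≢0 = ℕ.>-nonZero 1≤w

    p-1<p : p ∸ 1 < p
    p-1<p = ℕ.≤-reflexive (ℕ.suc-pred p)

    p-1≢0 : NonZero (p ∸ 1)
    p-1≢0 = ℕ.>-nonZero (ℕ.≤-trans 1≤w w≤p-1)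

    p∤w : ¬ + p ∣ + w
    p∤w = pos-∤ (ℕ.≤-<-trans w≤p-1 p-1<p)

    d : ℕ
    d = gcd w (p ∸ 1)

    instance
      d≢0 : NonZero d
      d≢0 = ℕ.≢-nonZero (gcd[m,n]≢0 w (p ∸ 1) (inj₁ (ℕ.≢-nonZero⁻¹ w)))

    -- Including 1 keeps the bound |S| ≥ N / (4 log₂ N) valid for N = 2.
    S : List ℕ
    S = 1 ∷ primes N

    S-OneOrPrime : ∀ {u} → u ∈ S → OneOrPrime u
    S-OneOrPrime (here refl) = inj₁ refl
    S-OneOrPrime (there u∈)  = inj₂ (proj₂ (∈-filter⁻ prime? {xs = upTo N} u∈))

    S<N : ∀ {u} → u ∈ S → u < N
    S<N (here refl) = 2≤N
    S<N (there u∈)  = ∈-upTo⁻ (proj₁ (∈-filter⁻ prime? {xs = upTo N} u∈))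

    S! : Unique S
    S! = All.tabulate (λ { u∈ refl → ¬prime[1] (proj₂ (∈-filter⁻ prime? {xs = upTo N} u∈)) }) ∷ Unique.filter⁺ prime? (Unique.upTo⁺ N)

    |S|≤p : length S ≤ p
    |S|≤p = ℕ.≤-trans (Unique-⊆⇒length≤ S! (∈-upTo⁺ ∘ S<N)) (ℕ.≤-trans (ℕ.≤-reflexive (length-upTo N)) N≤p)

    S<p : ∀ {u} → u ∈ S → u < p
    S<p u∈ = ℕ.<-≤-trans (S<N u∈) N≤p

    p∤S : ∀ {u} → u ∈ S → ¬ + p ∣ + u
    p∤S u∈ = pos-∤ {{OneOrPrime⇒NonZero (S-OneOrPrime u∈)}} (S<p u∈)

    -- `qs` ranges over all arguments below `N`, not only `S`, so that its length is `V w N p` by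
    -- definition.
    qs rs : List ℕ
    qs = deduplicate ℕ._≟_ (map (q p w) (upTo N))
    rs = deduplicate ℕ._≟_ (map (λ u → u ℕ.^ w ℕ.% p) S)

    qs! : Unique qs
    qs! = deduplicate-! ℕ._≟_ (map (q p w) (upTo N))

    rs! : Unique rs
    rs! = deduplicate-! ℕ._≟_ (map (λ u → u ℕ.^ w ℕ.% p) S)

    key : ℕ → ℕ × ℕ
    key u = q p w u , u ℕ.^ w ℕ.% p

    key∈ : ∀ {u} → u ∈ S → key u ∈ cartesianProduct qs rs
    key∈ u∈ = ∈-cartesianProduct⁺ (∈-deduplicate⁺ ℕ._≟_ (∈-map⁺ (q p w) (∈-upTo⁺ (S<N u∈))))
                                  (∈-deduplicate⁺ ℕ._≟_ (∈-map⁺ (λ u → u ℕ.^ w ℕ.% p) u∈))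

    -- With e = (p-1)/d, each residue u^w is a root of X^e - 1 modulo `p`, so there are at most e of
    -- them.
    |rs|*d≤p : length rs ℕ.* d ≤ p
    |rs|*d≤p with gcd[m,n]∣n w (p ∸ 1) | gcd[m,n]∣m w (p ∸ 1)
    ... | ℕ∣.divides e p-1≡ed | ℕ∣.divides f w≡fd = begin
      length rs ℕ.* d ≤⟨ ℕ.*-monoˡ-≤ d (ℕ.≤-trans (ℕ.≤-reflexive (sym (length-map +_ rs)))
                           (roots-of-unity-≤ pp e {{e≢0}} incongruent (All.map⁺ (All.tabulate root)))) ⟩
      e ℕ.* d         ≡⟨ p-1≡ed ⟨
      p ∸ 1           ≤⟨ ℕ.<⇒≤ p-1<p ⟩
      p               ∎
      where
      open ℕ.≤-Reasoning
      e≢0 : NonZero e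
      e≢0 = ℕ.m*n≢0⇒m≢0 e {{subst NonZero p-1≡ed p-1≢0}}
      rs∈ : ∀ {r} → r ∈ rs → Σ ℕ λ u → u ∈ S × r ≡ u ℕ.^ w ℕ.% p
      rs∈ r∈ = ∈-map⁻ _ (∈-deduplicate⁻ ℕ._≟_ (map (λ u → u ℕ.^ w ℕ.% p) S) r∈)
      rs<p : ∀ {r} → r ∈ rs → r < p
      rs<p r∈ with u , _ , refl ← rs∈ r∈ = ℕ.m%n<n (u ℕ.^ w) p
      incongruent : AllPairs (λ r s → ¬ r ≡ s [mod p ]) (map +_ rs)
      incongruent = AllPairs.map⁺ (Unique⇒AllPairs rs! λ r∈ s∈ r≢s r≡s → r≢s (≡mod⇒≡ (rs<p r∈) (rs<p s∈) r≡s))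
      -- Since d divides w, the exponent w (p-1)/d is a multiple of p - 1, and Fermat applies.
      exponent : w ℕ.* e ≡ (p ∸ 1) ℕ.* f
      exponent = begin-equality
        w ℕ.* e          ≡⟨ cong (ℕ._* e) w≡fd ⟩
        f ℕ.* d ℕ.* e    ≡⟨ rearrange f d e ⟩
        e ℕ.* d ℕ.* f    ≡⟨ cong (ℕ._* f) p-1≡ed ⟨
        (p ∸ 1) ℕ.* f    ∎
        where
        rearrange : ∀ f d e → f ℕ.* d ℕ.* e ≡ e ℕ.* d ℕ.* f
        rearrange = ℕ-solve-∀
      root : ∀ {r} → r ∈ rs → (+ r) ^ e ≡ 1ℤ [mod p ]
      root r∈ with u , u∈ , refl ← rs∈ r∈ =
        mod-trans (^-cong-mod e (mod-sym (%-≡mod (u ℕ.^ w) p)))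
          (mod-trans (≡⇒≡mod (trans (cong (_^ e) (pos-^ u w)) (trans (ℤ.^-*-assoc (+ u) w e) (cong ((+ u) ^_) exponent))))
            (^≡1mod (p ∸ 1) f (fermat′ pp u (p∤S u∈))))

    open Fibres (≡-dec ℕ._≟_ ℕ._≟_) key S (cartesianProduct qs rs)

    P : List (ℕ × ℕ)
    P = colliding-pairs

    P! : Unique P
    P! = colliding-pairs! S! (Unique.cartesianProduct⁺ qs! rs!)

    P₀ : List (ℕ × ℕ)
    P₀ = off-diagonal ℕ._≟_ P

    ∈-P₀ : ∀ {u v} → (u , v) ∈ P₀ →
           ((u ∈ S × v ∈ S) × u ≢ v) × (+ u) ^ w ≡ (+ v) ^ w [mod p ℕ.* p ] × (+ u) ^ w ≡ (+ v) ^ w [mod p ]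
    ∈-P₀ {u} {v} uv∈ =
      let uv∈P , u≢v = ∈-filter⁻ _ {xs = P} uv∈
          uv∈S , key≡ = ∈-colliding-pairs uv∈P
          u^w≡v^w = mod-trans (≡⇒≡mod (sym (pos-^ u w))) (mod-trans (%≡%⇒≡mod p (cong proj₂ key≡)) (≡⇒≡mod (pos-^ v w)))
      in (uv∈S , u≢v) , q-lift pp w u v (cong proj₁ key≡) u^w≡v^w , u^w≡v^w

    -- The quotient u/v modulo `p`: by Fermat v^(p-2) inverts v.
    ratio : ℕ × ℕ → ℤ
    ratio (u , v) = + u * (+ v) ^ (p ∸ 2)

    ratio-* : ∀ {u v} → v ∈ S → ratio (u , v) * + v ≡ + u [mod p ]
    ratio-* {u} {v} v∈ = begin
      + u * (+ v) ^ (p ∸ 2) * + v    ≡⟨ rearrange (+ u) ((+ v) ^ (p ∸ 2)) (+ v) ⟩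
      -- `suc (p ∸ 2)` is `p ∸ 1` because 2 ≤ N ≤ p.
      + u * (+ v) ^ suc (p ∸ 2)      ≡⟨ cong (λ n → + u * (+ v) ^ n) (sym (ℕ.+-∸-assoc 1 (ℕ.≤-trans 2≤N N≤p))) ⟩
      + u * (+ v) ^ (p ∸ 1)          ≈⟨ *-congˡ-mod (+ u) (fermat′ pp v (p∤S v∈)) ⟩
      + u * 1ℤ                       ≡⟨ ℤ.*-identityʳ (+ u) ⟩
      + u                            ∎
      where
      open import Relation.Binary.Reasoning.Setoid (mod-setoid {p})
      rearrange : ∀ u a v → u * a * v ≡ u * (v * a)
      rearrange = solve-∀

    ratio^≡1 : ∀ {u v} n → v ∈ S → (+ u) ^ n ≡ (+ v) ^ n [mod p ] → ratio (u , v) ^ n ≡ 1ℤ [mod p ]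
    ratio^≡1 {u} {v} n v∈ u^n≡v^n = *-cancelˡ-mod pp ((+ v) ^ n) (∤-^-prime pp (+ v) n (p∤S v∈)) (begin
      (+ v) ^ n * r ^ n    ≡⟨ ^-distribʳ-* n (+ v) r ⟨
      (+ v * r) ^ n        ≡⟨ cong (_^ n) (ℤ.*-comm (+ v) r) ⟩
      (r * + v) ^ n        ≈⟨ ^-cong-mod n (ratio-* v∈) ⟩
      (+ u) ^ n            ≈⟨ u^n≡v^n ⟩
      (+ v) ^ n            ≡⟨ ℤ.*-identityʳ _ ⟨
      (+ v) ^ n * 1ℤ       ∎)
      where
      open import Relation.Binary.Reasoning.Setoid (mod-setoid {p})
      r = ratio (u , v)

    ratio≡⇒cross≡ : ∀ {u v u′ v′} → v ∈ S → v′ ∈ S → ratio (u , v) ≡ ratio (u′ , v′) [mod p ] →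
                    + u * + v′ ≡ + u′ * + v [mod p ]
    ratio≡⇒cross≡ {u} {v} {u′} {v′} v∈ v′∈ r≡r′ = begin
      + u * + v′         ≈⟨ *-cong-mod (ratio-* {u} v∈) (≡⇒≡mod refl) ⟨
      r * + v * + v′     ≡⟨ rearrange r (+ v) (+ v′) ⟩
      + v * + v′ * r     ≈⟨ *-congˡ-mod (+ v * + v′) r≡r′ ⟩
      + v * + v′ * r′    ≡⟨ rearrange′ r′ (+ v) (+ v′) ⟩
      r′ * + v′ * + v    ≈⟨ *-cong-mod (ratio-* {u′} v′∈) (≡⇒≡mod refl) ⟩
      + u′ * + v         ∎
      where
      open import Relation.Binary.Reasoning.Setoid (mod-setoid {p})
      r = ratio (u , v)
      r′ = ratio (u′ , v′)
      rearrange : ∀ r v v′ → r * v * v′ ≡ v * v′ * r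
      rearrange = solve-∀
      rearrange′ : ∀ r v v′ → v * v′ * r ≡ r * v′ * v
      rearrange′ = solve-∀

    -- Together with `ratio≡⇒cross≡` this supplies the hypotheses of `^-unlift` for the products u
    -- v′ and u′ v.
    cross^≡ : ∀ {u v u′ v′} → (+ u) ^ w ≡ (+ v) ^ w [mod p ℕ.* p ] → (+ u′) ^ w ≡ (+ v′) ^ w [mod p ℕ.* p ] →
              (+ u * + v′) ^ w ≡ (+ u′ * + v) ^ w [mod p ℕ.* p ]
    cross^≡ {u} {v} {u′} {v′} u^w≡v^w u′^w≡v′^w = begin
      (+ u * + v′) ^ w          ≡⟨ ^-distribʳ-* w (+ u) (+ v′) ⟩
      (+ u) ^ w * (+ v′) ^ w    ≈⟨ *-cong-mod u^w≡v^w (mod-sym u′^w≡v′^w) ⟩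
      (+ v) ^ w * (+ u′) ^ w    ≡⟨ ℤ.*-comm ((+ v) ^ w) ((+ u′) ^ w) ⟩
      (+ u′) ^ w * (+ v) ^ w    ≡⟨ ^-distribʳ-* w (+ u′) (+ v) ⟨
      (+ u′ * + v) ^ w          ∎
      where open import Relation.Binary.Reasoning.Setoid (mod-setoid {p ℕ.* p})

    -- Both cross products are below p², so their congruence modulo p² is an equality.
    ratio-injective-mod : ∀ {x y} → x ∈ P₀ → y ∈ P₀ → ratio x ≡ ratio y [mod p ] → x ≡ y
    ratio-injective-mod {u , v} {u′ , v′} x∈ y∈ r≡r′ =
      let ((u∈ , v∈) , u≢v) , u^w≡v^w , _ = ∈-P₀ x∈
          ((u′∈ , v′∈) , _) , u′^w≡v′^w , _ = ∈-P₀ y∈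
          p∤uv′ = [ p∤S u∈ , p∤S v′∈ ]′ ∘ ∣-*-prime pp (+ u) (+ v′)
          uv′≡u′v = ^-unlift pp p∤w p∤uv′ (ratio≡⇒cross≡ {u} {v} {u′} {v′} v∈ v′∈ r≡r′)
                      (cross^≡ {u} {v} {u′} {v′} u^w≡v^w u′^w≡v′^w)
          u≡u′ , v≡v′ = ratio-injective (S-OneOrPrime u∈) (S-OneOrPrime v∈) (S-OneOrPrime u′∈) (S-OneOrPrime v′∈) u≢v
                          (≡mod⇒≡ (ℕ.*-mono-< (S<p u∈) (S<p v′∈)) (ℕ.*-mono-< (S<p u′∈) (S<p v∈))
                            (subst₂ _≡_[mod p ℕ.* p ] (sym (ℤ.pos-* u v′)) (sym (ℤ.pos-* u′ v)) uv′≡u′v))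
      in cong₂ _,_ u≡u′ v≡v′

    -- The ratios are pairwise incongruent modulo `p`. Their w-th powers are 1 by collision and
    -- their (p-1)-th powers by Fermat, so they are roots of X^d - 1.
    |P₀|≤d : length P₀ ≤ d
    |P₀|≤d = ℕ.≤-trans (ℕ.≤-reflexive (sym (length-map ratio P₀)))
      (roots-of-unity-≤ pp d
        (AllPairs.map⁺ (Unique⇒AllPairs (Unique.filter⁺ _ P!) λ x∈ y∈ x≢y r≡r′ → x≢y (ratio-injective-mod x∈ y∈ r≡r′)))
        (All.map⁺ (All.tabulate root)))
      where
      root : ∀ {x} → x ∈ P₀ → ratio x ^ d ≡ 1ℤ [mod p ]
      root {u , v} x∈ =
        let ((u∈ , v∈) , _) , _ , u^w≡v^w = ∈-P₀ x∈
        in ^-gcd≡1mod w (p ∸ 1) (ratio^≡1 {u} {v} w v∈ u^w≡v^w)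
             (ratio^≡1 {u} {v} (p ∸ 1) v∈ (mod-trans (fermat′ pp u (p∤S u∈)) (mod-sym (fermat′ pp v (p∤S v∈)))))

    -- One `p` bounds the diagonal, of size at most |S|; the other bounds d ≤ p - 1.
    |P|≤2p : length P ≤ p ℕ.+ p
    |P|≤2p = ℕ.≤-trans (length≤diagonal+off-diagonal ℕ._≟_ S P! (proj₁ ∘ proj₁ ∘ ∈-colliding-pairs))
      (ℕ.+-mono-≤ |S|≤p (ℕ.≤-trans |P₀|≤d (ℕ.≤-trans (gcd[m,n]≤n w (p ∸ 1) {{p-1≢0}}) (ℕ.<⇒≤ p-1<p))))

    -- Cauchy-Schwarz with |qs| |rs| possible keys; the factor d is absorbed by |rs| d ≤ p.
    d|S|²≤ : d ℕ.* (length S ℕ.* length S) ≤ V w N p ℕ.* p ℕ.* (p ℕ.+ p)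
    d|S|²≤ = begin
      d ℕ.* (length S ℕ.* length S)                               ≤⟨ ℕ.*-monoʳ-≤ d (length²≤ S! key∈) ⟩
      d ℕ.* (length (cartesianProduct qs rs) ℕ.* length P)        ≡⟨ cong (λ z → d ℕ.* (z ℕ.* length P)) (length-cartesianProduct qs rs) ⟩
      d ℕ.* (length qs ℕ.* length rs ℕ.* length P)                ≡⟨ rearrange d (length qs) (length rs) (length P) ⟩
      length qs ℕ.* (length rs ℕ.* d) ℕ.* length P                ≤⟨ ℕ.*-mono-≤ (ℕ.*-monoʳ-≤ (length qs) |rs|*d≤p) |P|≤2p ⟩
      length qs ℕ.* p ℕ.* (p ℕ.+ p)                               ∎
      where
      open ℕ.≤-Reasoning
      rearrange : ∀ d a b c → d ℕ.* (a ℕ.* b ℕ.* c) ≡ a ℕ.* (b ℕ.* d) ℕ.* c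
      rearrange = ℕ-solve-∀

    -- The constant is 32 = 4² · 2, with 4 from Chebyshev and 2 from the bound 2p on the colliding
    -- pairs.
    gcd*N²≤ : d ℕ.* N ℕ.^ 2 ≤ 32 ℕ.* (V w N p ℕ.* (p ℕ.* ⌊log₂ N ⌋) ℕ.^ 2)
    gcd*N²≤ = begin
      d ℕ.* N ℕ.^ 2                                               ≤⟨ ℕ.*-monoʳ-≤ d (ℕ.^-monoˡ-≤ 2 (chebyshev N 2≤N)) ⟩
      d ℕ.* (4 ℕ.* L ℕ.* length S) ℕ.^ 2                          ≡⟨ rearrange₁ d L (length S) ⟩
      16 ℕ.* (L ℕ.* L) ℕ.* (d ℕ.* (length S ℕ.* length S))        ≤⟨ ℕ.*-monoʳ-≤ (16 ℕ.* (L ℕ.* L)) d|S|²≤ ⟩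
      16 ℕ.* (L ℕ.* L) ℕ.* (V w N p ℕ.* p ℕ.* (p ℕ.+ p))          ≡⟨ rearrange₂ (V w N p) p L ⟩
      32 ℕ.* (V w N p ℕ.* (p ℕ.* L) ℕ.^ 2)                        ∎
      where
      open ℕ.≤-Reasoning
      L = ⌊log₂ N ⌋
      rearrange₁ : ∀ d L s → d ℕ.* ((4 ℕ.* L ℕ.* s) ℕ.* ((4 ℕ.* L ℕ.* s) ℕ.* 1)) ≡ 16 ℕ.* (L ℕ.* L) ℕ.* (d ℕ.* (s ℕ.* s))
      rearrange₁ = ℕ-solve-∀
      rearrange₂ : ∀ v p L → 16 ℕ.* (L ℕ.* L) ℕ.* (v ℕ.* p ℕ.* (p ℕ.+ p)) ≡ 32 ℕ.* (v ℕ.* ((p ℕ.* L) ℕ.* ((p ℕ.* L) ℕ.* 1)))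
      rearrange₂ = ℕ-solve-∀

open import Data.Nat using (ℕ; _*_; _^_; _≤_; _≥_; _∸_)

theorem3 : Σ ℕ (λ K → K ≥ 1 × ((p w N : ℕ) → Prime p → p ≢ 2 → 1 ≤ w → w ≤ p ∸ 1 → 2 ≤ N → N ≤ p → gcd w (p ∸ 1) * N ^ 2 ≤ K * (V w N p * (p * ⌊log₂ N ⌋) ^ 2)))
theorem3 = 32 , s≤s z≤n , λ p w N pp _ 1≤w w≤p-1 2≤N N≤p → ValueSet.Count.gcd*N²≤ pp 1≤w w≤p-1 2≤N N≤p
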